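{- Let $V$ be a vertex set with $|V|=n\ge 2$ and let $G$ be the disjoint union of $k$ spanning arborescences $A_1,\dots,A_k$ on $V$. If $k\ge 2n-3$, then $G$ has a rainbow spanning arborescence. Furthermore, if $n\ge 3$ and $k\ge 2n-4$, then $G$ has a rainbow spanning arborescence.
   Context: An arborescence is a connected digraph in which exactly one vertex (the root) has no incoming arc and every other vertex has exactly one incoming arc; it is spanning on $V$ if its vertex set is $V$. $G$ is the disjoint union of the arc sets $A_i$ (parallel arcs of different indices allowed). A subgraph $B$ of $G$ is rainbow if $|B\cap A_i|\le 1$ for all $i\in[k]$. -}

module Defs where

open import Data.Nat using (ℕ; zero; suc; _≤_; _+_; _*_)
open import Data.Fin using (Fin; _≟_)
open import Data.Product using (Σ; ∃; _×_; _,_; proj₁; proj₂)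
open import Data.List using (List; []; _∷_; length; filter; mapMaybe; allFin)
open import Data.List.Membership.Propositional using (_∈_)
open import Data.Maybe using (Maybe; just; nothing)
open import Relation.Binary.PropositionalEquality using (_≡_; _≢_)

-- An arc on vertex set V = Fin n is an ordered pair (tail , head).
Arc : ℕ → Set
Arc n = Fin n × Fin n

-- A digraph on V = Fin n, given by its arc (multi)set as a list of arcs
-- (parallel arcs are represented by repeated entries).
Digraph : ℕ → Set
Digraph n = List (Arc n)

indeg : ∀ {n} → Digraph n → Fin n → ℕ
indeg D v = length (filter (λ a → proj₂ a ≟ v) D)

data Walk {n : ℕ} (D : Digraph n) : Fin n → Fin n → Set where
  here : ∀ {u} → Walk D u u
  fwd  : ∀ {u w v} → (u , w) ∈ D → Walk D w v → Walk D u v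
  bwd  : ∀ {u w v} → (w , u) ∈ D → Walk D w v → Walk D u v

Connected : ∀ {n} → Digraph n → Set
Connected {n} D = (u v : Fin n) → Walk D u v

IsSpanningArborescence : ∀ {n} → Digraph n → Set
IsSpanningArborescence {n} D =
  Connected D ×
  (Σ (Fin n) λ r → indeg D r ≡ 0 × ((v : Fin n) → v ≢ r → indeg D v ≡ 1))

-- G is the disjoint union of the arc sets A i (i ∈ [k]).  A rainbow subgraph
-- B of G picks at most one arc from each A i: it is given by a choice
-- B i ∈ Maybe (Arc n) with B i ≡ just a only if a ∈ A i.
IsRainbowSubgraph : ∀ {n k} → (Fin k → Digraph n) → (Fin k → Maybe (Arc n)) → Set
IsRainbowSubgraph {n} {k} A B = (i : Fin k) (a : Arc n) → B i ≡ just a → a ∈ A i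

arcsOf : ∀ {n k} → (Fin k → Maybe (Arc n)) → Digraph n
arcsOf {n} {k} B = mapMaybe B (allFin k)

HasRainbowSpanningArborescence : ∀ {n k} → (Fin k → Digraph n) → Set
HasRainbowSpanningArborescence {n} {k} A =
  Σ (Fin k → Maybe (Arc n)) λ B →
    IsRainbowSubgraph A B × IsSpanningArborescence (arcsOf B)

{-# OPTIONS --safe #-}
module Submission where

-- Grow a rainbow subgraph as in the path-based algorithm for strong components. Its arcs
-- are split into a core K, whose strong components have representatives v ∷ Q ++ U, and
-- links L forming a path through the components of the stack v ∷ Q; the components in U
-- are not yet visited. If every unused colour is rooted in the component of v, the unused
-- colours extend what v reaches one component at a time. Otherwise an unused colour has an
-- arc entering the component of v from outside: from U it extends the path, from Q it
-- closes a cycle of components, which becomes part of the core. A cycle through m ≥ 2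
-- components costs m colours and removes m - 1 components, so 2n - 3 colours suffice.
-- With 2n - 4 colours only one configuration is critical: closing a 2-cycle when Q and U
-- are singletons. There the colour of the link is spent differently.

open import Defs
open import Data.Nat using (ℕ; zero; suc; _≤_; _+_; _*_; z≤n; s≤s; s≤s⁻¹)
open import Data.Nat.Properties using (+-suc; +-assoc; +-comm; +-identityʳ; ≤-trans; ≤-reflexive; m≤n+m; m≤n⇒m≤1+n; +-monoˡ-≤; suc-injective; module ≤-Reasoning)
open import Data.Fin using (Fin; zero; suc; _≟_)
open import Data.Product using (∃; ∃₂; _×_; _,_; proj₁; proj₂)
open import Data.Sum using (_⊎_; inj₁; inj₂; [_,_]′; swap)
import Data.Sum as Sum
open import Data.Maybe using (Maybe; just; nothing)
open import Data.Empty using (⊥-elim)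
open import Data.List using (List; []; _∷_; [_]; _++_; length; filter; map; mapMaybe; allFin; tabulate)
open import Data.List.Properties using (filter-none; filter-accept; length-++; length-tabulate; ++-assoc; ++-identityʳ)
open import Data.List.Membership.Propositional using (_∈_; _∉_; find)
open import Data.List.Membership.Propositional.Properties using (∈-∃++; ∈-filter⁺; ∈-++⁻; ∈-allFin; ∈-map⁺; ∈-tabulate⁺)
import Data.List.Membership.DecPropositional as DecMembership
open import Data.List.Relation.Unary.Any using (here; there)
open import Data.List.Relation.Unary.All as All using (All; []; _∷_)
open import Data.List.Relation.Unary.AllPairs using ([]; _∷_)
open import Data.List.Relation.Unary.Unique.Propositional using (Unique)
open import Data.List.Relation.Unary.Unique.Propositional.Properties using (allFin⁺)
open import Data.List.Relation.Binary.Subset.Propositional using (_⊆_)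
open import Data.List.Relation.Binary.Subset.Propositional.Properties using (xs⊆ys++xs)
open import Data.List.Relation.Binary.Permutation.Propositional using (_↭_; ↭-refl; ↭-sym; ↭-trans; ↭-reflexive; ↭⇒↭ₛ)
import Data.List.Relation.Binary.Permutation.Propositional.Properties as Perm
import Data.List.Relation.Binary.Permutation.Setoid.Properties as PermSetoid
open import Relation.Binary.Construct.Closure.ReflexiveTransitive as Star using (Star; ε; _◅_; _◅◅_)
open import Relation.Binary.PropositionalEquality using (_≡_; _≢_; refl; sym; trans; cong; subst; setoid; module ≡-Reasoning)
open import Relation.Nullary using (yes; no)
open import Function using (_∘_; id)

-- Uniqueness, extraction and `mapMaybe` for lists

unique-++ʳ : ∀ {A : Set} (xs : List A) {ys} → Unique (xs ++ ys) → Unique ys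
unique-++ʳ []       u       = u
unique-++ʳ (x ∷ xs) (_ ∷ u) = unique-++ʳ xs u

unique-resp-↭ : ∀ {A : Set} {xs ys : List A} → xs ↭ ys → Unique xs → Unique ys
unique-resp-↭ {A} p = PermSetoid.Unique-resp-↭ (setoid A) (↭⇒↭ₛ p)

extract : ∀ {A : Set} {x : A} {xs} → x ∈ xs → ∃ λ ys → xs ↭ x ∷ ys
extract {x = x} x∈xs with ys , zs , refl ← ∈-∃++ x∈xs = ys ++ zs , Perm.shift x ys zs

unique-keys-functional : ∀ {A B : Set} {X : List (A × B)} → Unique (map proj₁ X) →
  ∀ {c a b} → (c , a) ∈ X → (c , b) ∈ X → a ≡ b
unique-keys-functional (_ ∷ _) (here refl) (here refl) = refl
unique-keys-functional (c≢ ∷ _) (here refl) (there q) = ⊥-elim (All.lookup c≢ (∈-map⁺ proj₁ q) refl)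
unique-keys-functional (c≢ ∷ _) (there p) (here refl) = ⊥-elim (All.lookup c≢ (∈-map⁺ proj₁ p) refl)
unique-keys-functional (_ ∷ u) (there p) (there q) = unique-keys-functional u p q

∈-mapMaybe⁺ : ∀ {A B : Set} (f : A → Maybe B) {x y xs} → x ∈ xs → f x ≡ just y → y ∈ mapMaybe f xs
∈-mapMaybe⁺ f {x} (here refl) eq with f x | eq
... | just _ | refl = here refl
∈-mapMaybe⁺ f {xs = z ∷ _} (there p) eq with f z
... | just _  = there (∈-mapMaybe⁺ f p eq)
... | nothing = ∈-mapMaybe⁺ f p eq

∈-mapMaybe⁻ : ∀ {A B : Set} (f : A → Maybe B) xs {y} → y ∈ mapMaybe f xs → ∃ λ x → x ∈ xs × f x ≡ just y
∈-mapMaybe⁻ f (x ∷ xs) p with f x in eq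
∈-mapMaybe⁻ f (x ∷ xs) (here refl) | just _ = x , here refl , eq
∈-mapMaybe⁻ f (x ∷ xs) (there p) | just _ with z , z∈ , e ← ∈-mapMaybe⁻ f xs p = z , there z∈ , e
∈-mapMaybe⁻ f (x ∷ xs) p | nothing with z , z∈ , e ← ∈-mapMaybe⁻ f xs p = z , there z∈ , e

-- Walks and directed reachability

-- Follow the walk while `cover` answers `N`; the first answer `P` yields the crossing edge. `N` and
-- `P` may overlap, so a walk without such an edge only gives `N` at its end.
crossing : ∀ {V : Set} {E : V → V → Set} {N P : V → Set} → (∀ z → N z ⊎ P z) →
  ∀ {a b} → Star E a b → N a → (∃₂ λ x y → E x y × N x × P y) ⊎ N b
crossing cover ε        na = inj₂ na
crossing cover (_◅_ {a} {y} e es) na with cover y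
... | inj₁ ny = crossing cover es ny
... | inj₂ py = inj₁ (a , y , e , na , py)

last-edge : ∀ {V : Set} {E : V → V → Set} {a b} → Star E a b → a ≡ b ⊎ ∃ λ x → Star E a x × E x b
last-edge ε = inj₁ refl
last-edge (e ◅ es) with last-edge es
... | inj₁ refl          = inj₂ (_ , ε , e)
... | inj₂ (x , p , e′)  = inj₂ (x , e ◅ p , e′)

walk-++ : ∀ {n} {D : Digraph n} {u v w} → Walk D u v → Walk D v w → Walk D u w
walk-++ here       q = q
walk-++ (fwd e p) q = fwd e (walk-++ p q)
walk-++ (bwd e p) q = bwd e (walk-++ p q)

walk-reverse : ∀ {n} {D : Digraph n} {u v} → Walk D u v → Walk D v u
walk-reverse here      = here
walk-reverse (fwd e p) = walk-++ (walk-reverse p) (bwd e here)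
walk-reverse (bwd e p) = walk-++ (walk-reverse p) (fwd e here)

Arrow : ∀ {n} → Digraph n → Fin n → Fin n → Set
Arrow D x y = (x , y) ∈ D

unique-tail : ∀ {n} (D : Digraph n) {x x′ y} → indeg D y ≡ 1 → Arrow D x y → Arrow D x′ y → x ≡ x′
unique-tail D {y = y} eq p q
  with filter (λ a → proj₂ a ≟ y) D | ∈-filter⁺ (λ a → proj₂ a ≟ y) p refl | ∈-filter⁺ (λ a → proj₂ a ≟ y) q refl | eq
... | _ ∷ [] | here refl | here refl | refl = refl

head-indeg≢0 : ∀ {n} (D : Digraph n) {x y} → Arrow D x y → indeg D y ≢ 0
head-indeg≢0 D {y = y} p eq
  with filter (λ a → proj₂ a ≟ y) D | ∈-filter⁺ (λ a → proj₂ a ≟ y) p refl | eq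
... | [] | () | _

-- Scan the undirected walk from `r`, keeping a directed path from `r` to the current vertex. A
-- backward step must retrace the last arc of that path, since in-degree one leaves no other arc
-- into the vertex.
arborescence-reach : ∀ {n} (D : Digraph n) → IsSpanningArborescence D →
  ∃ λ r → ∀ z → Star (Arrow D) r z
arborescence-reach D (connected , r , r-source , in-one) = r , λ z → along ε (connected r z)
  where
  along : ∀ {u z} → Star (Arrow D) r u → Walk D u z → Star (Arrow D) r z
  along p here = p
  along p (fwd e w) = along (p ◅◅ e ◅ ε) w
  along {u} p (bwd e w) with last-edge p
  ... | inj₁ refl = ⊥-elim (head-indeg≢0 D e r-source)
  ... | inj₂ (x , q , e′) with u ≟ r
  ...   | yes refl = ⊥-elim (head-indeg≢0 D e r-source)
  ...   | no u≢r with refl ← unique-tail D (in-one u u≢r) e′ e = along q w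

indeg-none : ∀ {n} (D : Digraph n) {v} → (∀ {x} → (x , v) ∉ D) → indeg D v ≡ 0
indeg-none D {v} none = cong length (filter-none (λ a → proj₂ a ≟ v) {D} (All.tabulate λ { p refl → none p }))

indeg-one : ∀ {n k} (B : Fin k → Maybe (Arc n)) {i x v} → B i ≡ just (x , v) →
  (∀ {j y} → B j ≡ just (y , v) → j ≡ i) →
  ∀ is → Unique is → i ∈ is → indeg (mapMaybe B is) v ≡ 1
indeg-one B {i} {x} {v} eq only (.i ∷ is) (i∉ ∷ _) (here refl)
  rewrite eq | filter-accept (λ a → proj₂ a ≟ v) {x , v} {mapMaybe B is} refl =
  cong suc (indeg-none (mapMaybe B is) λ p →
    let j , j∈ , e = ∈-mapMaybe⁻ B is p in All.lookup i∉ j∈ (sym (only e)))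
indeg-one B {v = v} eq only (j ∷ is) (j∉ ∷ u) (there i∈) with B j in eqj
... | nothing = indeg-one B eq only is u i∈
... | just (y , w) with w ≟ v
...   | yes refl = ⊥-elim (All.lookup j∉ i∈ (only eqj))
...   | no _ = indeg-one B eq only is u i∈

-- Counting unused colours

-- c unused colours, q components below the top of the stack, m unvisited components.
Enough : ℕ → ℕ → ℕ → Set
Enough c q m = q + (m + m) ≤ suc c ⊎ (q + (m + m) ≤ suc (suc c) × 2 ≤ q + m)

double-suc : ∀ q m → q + (suc m + suc m) ≡ suc (suc (q + (m + m)))
double-suc q m = begin
  q + suc (m + suc m)     ≡⟨ +-suc q (m + suc m) ⟩
  suc (q + (m + suc m))   ≡⟨ cong (λ t → suc (q + t)) (+-suc m m) ⟩
  suc (q + suc (m + m))   ≡⟨ cong suc (+-suc q (m + m)) ⟩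
  suc (suc (q + (m + m))) ∎
  where open ≡-Reasoning

-- In the second alternative the side condition `2 ≤ q + m` pays for the extra unit of slack.
enough-for-unvisited : ∀ {c m} q → Enough c q (suc m) → suc m ≤ c
enough-for-unvisited {c} {m} q (inj₁ le) rewrite double-suc q m =
  ≤-trans (s≤s (≤-trans (m≤n+m m m) (m≤n+m (m + m) q))) (s≤s⁻¹ le)
enough-for-unvisited {c} {m} q (inj₂ (le , two)) = s≤s⁻¹ (s≤s⁻¹ (begin
  2 + suc m             ≤⟨ +-monoˡ-≤ (suc m) two ⟩
  q + suc m + suc m     ≡⟨ +-assoc q (suc m) (suc m) ⟩
  q + (suc m + suc m)   ≤⟨ le ⟩
  suc (suc c)           ∎))
  where open ≤-Reasoning

-- An unvisited component weighs two and one below the top weighs one, so a push lowers both sides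
-- by one and keeps `q + m`.
enough-push : ∀ {c q m} → Enough (suc c) q (suc m) → Enough c (suc q) m
enough-push {q = q} {m} (inj₁ le) rewrite double-suc q m = inj₁ (s≤s⁻¹ le)
enough-push {q = q} {m} (inj₂ (le , two)) rewrite double-suc q m | +-suc q m = inj₂ (s≤s⁻¹ le , two)

-- Here `a` counts the components strictly between the top and the one hit. The weight drops by
-- `a + 1` for one colour: if `a` is positive the extra slack is no longer used, and if `a` is zero
-- only the side condition can fail.
enough-collapse : ∀ {c m} a q → Enough (suc c) (a + suc q) (suc m) →
  Enough c q (suc m) ⊎ (a ≡ 0 × q ≡ 0 × m ≡ 0)
enough-collapse {m = m} a q (inj₁ le) rewrite +-suc a q | +-assoc a q (suc m + suc m) =
  inj₁ (inj₁ (≤-trans (m≤n+m _ a) (s≤s⁻¹ le)))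
enough-collapse {m = m} (suc a) q (inj₂ (le , _)) rewrite +-suc a q | +-assoc a q (suc m + suc m) =
  inj₁ (inj₁ (≤-trans (m≤n+m _ a) (s≤s⁻¹ (s≤s⁻¹ le))))
enough-collapse {m = zero}  zero zero    _               = inj₂ (refl , refl , refl)
enough-collapse {m = suc m} zero zero    (inj₂ (le , _)) = inj₁ (inj₂ (s≤s⁻¹ le , s≤s (s≤s z≤n)))
enough-collapse {m = m}     zero (suc q) (inj₂ (le , _)) = inj₁ (inj₂ (s≤s⁻¹ le , s≤s (≤-trans (s≤s z≤n) (m≤n+m (suc m) q))))

-- Coloured arcs

Coloured : ℕ → ℕ → Set
Coloured n k = Fin k × Arc n

module _ {n k : ℕ} where

  Edge : List (Coloured n k) → Fin n → Fin n → Set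
  Edge X x y = ∃ λ c → (c , x , y) ∈ X

  Reach : List (Coloured n k) → Fin n → Fin n → Set
  Reach X = Star (Edge X)

  Equiv : List (Coloured n k) → Fin n → Fin n → Set
  Equiv X x y = Reach X x y × Reach X y x

  Near : List (Coloured n k) → List (Fin n) → Fin n → Set
  Near X R z = ∃ λ r → r ∈ R × Equiv X z r

  reach-mono : ∀ {X Y} → X ⊆ Y → ∀ {x y} → Reach X x y → Reach Y x y
  reach-mono X⊆Y = Star.map λ (c , p) → c , X⊆Y p

  equiv-mono : ∀ {X Y} → X ⊆ Y → ∀ {x y} → Equiv X x y → Equiv Y x y
  equiv-mono X⊆Y (p , q) = reach-mono X⊆Y p , reach-mono X⊆Y q

  head-edge : ∀ {c x y X} → Reach ((c , x , y) ∷ X) x y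
  head-edge = (_ , here refl) ◅ ε

  -- Out-trees inside a set of coloured arcs

  heads : List (Coloured n k) → List (Fin n)
  heads = map (proj₂ ∘ proj₂)

  -- An out-tree from `r` listed by its leaves, newest first. Its vertex set is `r ∷ heads F`, so
  -- each vertex other than `r` enters with exactly one arc.
  data Tree (r : Fin n) : List (Coloured n k) → Set where
    root : Tree r []
    leaf : ∀ {c x y F} → x ∈ r ∷ heads F → y ∉ r ∷ heads F → Tree r F → Tree r ((c , x , y) ∷ F)

  open DecMembership (_≟_ {n}) using (_∈?_)

  -- Walk along the path with the current vertex always in the tree; a vertex not yet present is
  -- attached by the edge that leads to it.
  tree-grow : ∀ {X r x z F} → Reach X x z → x ∈ r ∷ heads F → Tree r F → F ⊆ X →
    ∃ λ F′ → Tree r F′ × F′ ⊆ X × (r ∷ heads F ⊆ r ∷ heads F′) × z ∈ r ∷ heads F′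
  tree-grow ε x∈ t F⊆X = _ , t , F⊆X , id , x∈
  tree-grow {r = r} {F = F} (_◅_ {j = y} (c , e) p) x∈ t F⊆X with y ∈? (r ∷ heads F)
  ... | yes y∈ = tree-grow p y∈ t F⊆X
  ... | no  y∉ with F′ , t′ , F′⊆X , mono , z∈ ← tree-grow p (there (here refl)) (leaf {c = c} x∈ y∉ t)
                        (λ { (here refl) → e ; (there q) → F⊆X q }) =
    F′ , t′ , F′⊆X , mono ∘ (λ { (here q) → here q ; (there q) → there (there q) }) , z∈

  tree-cover : ∀ {X r} → (∀ z → Reach X r z) → ∀ zs →
    ∃ λ F → Tree r F × F ⊆ X × zs ⊆ r ∷ heads F
  tree-cover reach [] = [] , root , (λ ()) , λ ()
  tree-cover reach (z ∷ zs)
    with F , t , F⊆X , zs⊆ ← tree-cover reach zs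
    with F′ , t′ , F′⊆X , mono , z∈ ← tree-grow (reach z) (here refl) t F⊆X =
    F′ , t′ , F′⊆X , λ { (here refl) → z∈ ; (there q) → mono (zs⊆ q) }

  ∈-heads : ∀ {c x y F} → (c , x , y) ∈ F → y ∈ heads F
  ∈-heads = ∈-map⁺ (proj₂ ∘ proj₂)

  tree-head≢root : ∀ {r F} → Tree r F → ∀ {c x y} → (c , x , y) ∈ F → y ≢ r
  tree-head≢root (leaf _ y∉ _) (here refl) refl = y∉ (here refl)
  tree-head≢root (leaf _ _ t) (there p) = tree-head≢root t p

  tree-colour-unique : ∀ {r F} → Tree r F → ∀ {c d x x′ y} → (c , x , y) ∈ F → (d , x′ , y) ∈ F → c ≡ d
  tree-colour-unique (leaf _ _ _)  (here refl) (here refl) = refl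
  tree-colour-unique (leaf _ y∉ _) (here refl) (there q)   = ⊥-elim (y∉ (there (∈-heads q)))
  tree-colour-unique (leaf _ y∉ _) (there p) (here refl)   = ⊥-elim (y∉ (there (∈-heads p)))
  tree-colour-unique (leaf _ _ t)  (there p) (there q)     = tree-colour-unique t p q

  tree-parent : ∀ {F y} → y ∈ heads F → ∃₂ λ c x → (c , x , y) ∈ F
  tree-parent {_ ∷ _} (here refl) = _ , _ , here refl
  tree-parent {_ ∷ _} (there p) with c , x , q ← tree-parent p = c , x , there q

  tree-walk : ∀ {r F D} → Tree r F → (∀ {c a} → (c , a) ∈ F → a ∈ D) →
    ∀ {y} → y ∈ r ∷ heads F → Walk D r y
  tree-walk root F⊆D (here refl) = here
  tree-walk (leaf _ _ _)  F⊆D (here refl) = here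
  tree-walk (leaf x∈ _ t) F⊆D (there (here refl)) =
    walk-++ (tree-walk t (F⊆D ∘ there) x∈) (fwd (F⊆D (here refl)) here)
  tree-walk (leaf _ _ t)  F⊆D (there (there p)) = tree-walk t (F⊆D ∘ there) (there p)

  -- From a spanning out-tree to a rainbow arborescence

  arcOf : List (Coloured n k) → Fin k → Maybe (Arc n)
  arcOf [] i = nothing
  arcOf ((c , a) ∷ F) i with c ≟ i
  ... | yes _ = just a
  ... | no  _ = arcOf F i

  arcOf⁻ : ∀ F {i a} → arcOf F i ≡ just a → (i , a) ∈ F
  arcOf⁻ ((c , a) ∷ F) {i} eq with c ≟ i
  ... | yes refl with refl ← eq = here refl
  ... | no _ = there (arcOf⁻ F eq)

  arcOf-defined : ∀ F {i a} → (i , a) ∈ F → ∃ λ b → arcOf F i ≡ just b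
  arcOf-defined ((c , a) ∷ F) {i} p with c ≟ i
  ... | yes refl = a , refl
  arcOf-defined ((c , a) ∷ F) (here refl) | no c≢i = ⊥-elim (c≢i refl)
  arcOf-defined ((c , a) ∷ F) (there p) | no _ = arcOf-defined F p

module _ {n k : ℕ} (A : Fin k → Digraph n) where

  record Rainbow (C : List (Fin k)) (X : List (Coloured n k)) : Set where
    constructor rainbow
    field
      distinct : Unique (C ++ map proj₁ X)
      valid    : All (λ (c , a) → a ∈ A c) X

  Spanning : Set
  Spanning = ∃ λ C → ∃₂ λ X v → Rainbow C X × ∀ z → Reach X v z

  spanning⇒arborescence : Spanning → HasRainbowSpanningArborescence A
  spanning⇒arborescence (C , X , r , rainbow distinct valid , reach)
    with F , t , F⊆X , all∈ ← tree-cover reach (allFin n) =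
    B , (λ i a eq → All.lookup valid (F⊆X (arcOf⁻ F eq))) ,
    (λ u v → walk-++ (walk-reverse (walk u)) (walk v)) ,
    r , indeg-none (arcsOf B) (λ p → tree-head≢root t (proj₂ (∈arcs⁻ p)) refl) , in-one
    where
    B : Fin k → Maybe (Arc n)
    B = arcOf F

    -- `arcOf` returns the first arc of a colour; distinctness of the colours in `X` makes it the
    -- only one.
    B-complete : ∀ {c a} → (c , a) ∈ F → B c ≡ just a
    B-complete p with b , eq ← arcOf-defined F p =
      trans eq (cong just (unique-keys-functional (unique-++ʳ C distinct) (F⊆X (arcOf⁻ F eq)) (F⊆X p)))

    ∈arcs⁺ : ∀ {c a} → (c , a) ∈ F → a ∈ arcsOf B
    ∈arcs⁺ {c} p = ∈-mapMaybe⁺ B (∈-allFin c) (B-complete p)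

    ∈arcs⁻ : ∀ {a} → a ∈ arcsOf B → ∃ λ c → (c , a) ∈ F
    ∈arcs⁻ p with c , _ , eq ← ∈-mapMaybe⁻ B (allFin k) p = c , arcOf⁻ F eq

    walk : ∀ v → Walk (arcsOf B) r v
    walk v = tree-walk t ∈arcs⁺ (all∈ (∈-allFin v))

    in-one : ∀ v → v ≢ r → indeg (arcsOf B) v ≡ 1
    in-one v v≢r with all∈ (∈-allFin v)
    ... | here v≡r = ⊥-elim (v≢r v≡r)
    ... | there v∈ with c , x , p ← tree-parent v∈ =
      indeg-one B (B-complete p) (λ eq → tree-colour-unique t (arcOf⁻ F eq) p) (allFin k) (allFin⁺ k) (∈-allFin c)

  -- Growing a rainbow subgraph

  rainbow-resp-↭ : ∀ {C C′ X X′} → C ↭ C′ → X ↭ X′ → Rainbow C X → Rainbow C′ X′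
  rainbow-resp-↭ p q (rainbow distinct valid) =
    rainbow (unique-resp-↭ (Perm.++⁺ p (Perm.map⁺ proj₁ q)) distinct) (Perm.All-resp-↭ q valid)

  rainbow-add : ∀ {i C X a} → a ∈ A i → Rainbow (i ∷ C) X → Rainbow C ((i , a) ∷ X)
  rainbow-add {i} {C} {X} a∈ (rainbow distinct valid) =
    rainbow (unique-resp-↭ (↭-sym (Perm.shift i C (map proj₁ X))) distinct) (a∈ ∷ valid)

  rainbow-replace : ∀ {C c a b X} → b ∈ A c → Rainbow C ((c , a) ∷ X) → Rainbow C ((c , b) ∷ X)
  rainbow-replace b∈ (rainbow distinct (_ ∷ valid)) = rainbow distinct (b∈ ∷ valid)

  -- From here on an arborescence enters only through a vertex from which its arcs reach everything.
  module _ (source : Fin k → Fin n) (reach : ∀ i z → Star (Arrow (A i)) (source i) z) where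

    absorb : ∀ {i} {X : List (Coloured n k)} {U v x y u} → (∀ z → Reach X v z ⊎ Near X U z) → Reach X v x → Reach X y u → u ∈ U →
      ∃ λ U′ → U ↭ u ∷ U′ × ∀ z → Reach ((i , x , y) ∷ X) v z ⊎ Near ((i , x , y) ∷ X) U′ z
    absorb {i} {X} {U} {v} {x} {y} cover v⟶x y⟶u u∈ with U′ , perm ← extract u∈ = U′ , perm , cover′
      where
      cover′ : ∀ z → Reach ((i , x , y) ∷ X) v z ⊎ Near ((i , x , y) ∷ X) U′ z
      cover′ z with cover z
      ... | inj₁ v⟶z = inj₁ (reach-mono there v⟶z)
      ... | inj₂ (u′ , u′∈ , z≈u′) with Perm.∈-resp-↭ perm u′∈
      ...   | here refl = inj₁ (reach-mono there v⟶x ◅◅ head-edge ◅◅ reach-mono there (y⟶u ◅◅ proj₂ z≈u′))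
      ...   | there q   = inj₂ (u′ , q , equiv-mono there z≈u′)

    -- The path in colour `i` from its source to `u₀` either leaves the set reached from `v`, and
    -- its crossing arc absorbs one component at the cost of `i`, or shows that `u₀` is reached
    -- already, at no cost.
    extend-to-all : ∀ {v} C X U → Rainbow C X → length U ≤ length C →
      All (λ i → Reach X v (source i)) C → (∀ z → Reach X v z ⊎ Near X U z) → Spanning
    extend-to-all C X [] rb _ _ cover = C , X , _ , rb , λ z → [ id , (λ { (_ , () , _) }) ]′ (cover z)
    extend-to-all {v} (i ∷ C) X (u₀ ∷ U₀) rb (s≤s le) (s ∷ ss) cover =
      [ (λ (x , y , xy , v⟶x , u , u∈ , y⟶u , _) →
          let U′ , perm , cover′ = absorb cover v⟶x y⟶u u∈ in
          extend-to-all C ((i , x , y) ∷ X) U′ (rainbow-add xy rb)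
            (≤-trans (s≤s⁻¹ (≤-reflexive (sym (Perm.↭-length perm)))) le)
            (All.map (reach-mono there) ss) cover′)
      , (λ v⟶u₀ → extend-to-all (i ∷ C) X U₀ rb (m≤n⇒m≤1+n le) (s ∷ ss) λ z →
          [ inj₁
          , (λ { (_ , here refl , _ , u₀⟶z) → inj₁ (v⟶u₀ ◅◅ u₀⟶z)
               ; (u , there u∈ , z≈u)       → inj₂ (u , u∈ , z≈u) }) ]′ (cover z))
      ]′ (crossing cover (reach i u₀) s)

    -- The stack of components and its path of links

    data Links (K : List (Coloured n k)) : List (Coloured n k) → Fin n → List (Fin n) → Set where
      []   : ∀ {v} → Links K [] v []
      -- The arc points from the newer component down to the older one, so the top reaches the whole
      -- stack.
      link : ∀ {c x y L v q Q} → Reach K v x → Reach K y q → Links K L q Q →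
             Links K ((c , x , y) ∷ L) v (q ∷ Q)

    links-mono : ∀ {K K′ L v Q} → K ⊆ K′ → Links K L v Q → Links K′ L v Q
    links-mono K⊆ [] = []
    links-mono K⊆ (link p q ls) = link (reach-mono K⊆ p) (reach-mono K⊆ q) (links-mono K⊆ ls)

    link-reach : ∀ {K : List (Coloured n k)} {c x y v q} L → Reach K v x → Reach K y q → Reach ((c , x , y) ∷ L ++ K) v q
    link-reach L p q = reach-mono K⊆ p ◅◅ head-edge ◅◅ reach-mono K⊆ q
      where
      K⊆ : ∀ {K e} → K ⊆ e ∷ L ++ K
      K⊆ {K} = there ∘ xs⊆ys++xs K L

    links-reach : ∀ {K L v Q q} → Links K L v Q → q ∈ Q → Reach (L ++ K) v q
    links-reach (link {L = L} p q ls) (here refl) = link-reach L p q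
    links-reach (link {L = L} p q ls) (there q∈)  = link-reach L p q ◅◅ reach-mono there (links-reach ls q∈)

    -- The path is cut at `q`. Together with an arc from the component of `q` back to that of `v`,
    -- `above` makes all of `v ∷ Q₁` strongly connected with `q`.
    record Split (K L : List (Coloured n k)) (v : Fin n) (Q : List (Fin n)) (q : Fin n) : Set where
      constructor split
      field
        L₁ L₂   : List (Coloured n k)
        Q₁ Q₂   : List (Fin n)
        L-split : L ≡ L₁ ++ L₂
        Q-split : Q ≡ Q₁ ++ q ∷ Q₂
        below   : Links K L₂ q Q₂
        above   : ∀ {p} → p ∈ v ∷ Q₁ → Reach (L₁ ++ K) v p × Reach (L₁ ++ K) p q

    links-split : ∀ {K L v Q q} → Links K L v Q → q ∈ Q → Split K L v Q q
    links-split (link {c} {x} {y} {L} p q ls) (here refl) =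
      split [ c , x , y ] L [] _ refl refl ls λ { (here refl) → ε , link-reach [] p q }
    links-split (link {c} {x} {y} {q = q′} p q ls) (there q∈)
      with split L₁ L₂ Q₁ Q₂ refl refl below above ← links-split ls q∈ =
      split ((c , x , y) ∷ L₁) L₂ (q′ ∷ Q₁) Q₂ refl refl below λ where
        (here refl) → ε , link-reach L₁ p q ◅◅ reach-mono there (proj₂ (above (here refl)))
        (there p∈)  → link-reach L₁ p q ◅◅ reach-mono there (proj₁ (above p∈)) ,
                      reach-mono there (proj₂ (above p∈))

    -- Two representatives may share a component, so the lengths of `Q` and `U` are upper bounds.
    -- `classes` sets the component of `v` apart, ready for a crossing into it from outside.
    record State (C : List (Fin k)) (K L : List (Coloured n k)) (v : Fin n) (Q U : List (Fin n)) : Set where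
      constructor state
      field
        isRainbow : Rainbow C (L ++ K)
        links     : Links K L v Q
        classes   : ∀ z → (Near K Q z ⊎ Near K U z) ⊎ Equiv K z v

    push : ∀ {i C K L v Q U U′ x y u} → Arrow (A i) x y → Equiv K y v → Equiv K x u → U ↭ u ∷ U′ →
      State (i ∷ C) K L v Q U → State C K ((i , x , y) ∷ L) u (v ∷ Q) U′
    push {K = K} {v = v} {Q} {U} {U′} {u = u} xy y≈v x≈u perm (state rb ls classes) =
      state (rainbow-add xy rb) (link (proj₂ x≈u) (proj₁ y≈v) ls) classes′
      where
      classes′ : ∀ z → (Near K (v ∷ Q) z ⊎ Near K U′ z) ⊎ Equiv K z u
      classes′ z with classes z
      ... | inj₂ z≈v = inj₁ (inj₁ (v , here refl , z≈v))
      ... | inj₁ (inj₁ (q , q∈ , z≈q)) = inj₁ (inj₁ (q , there q∈ , z≈q))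
      ... | inj₁ (inj₂ (u′ , u′∈ , z≈u′)) with Perm.∈-resp-↭ perm u′∈
      ...   | here refl = inj₂ z≈u′
      ...   | there p   = inj₁ (inj₂ (u′ , p , z≈u′))

    -- The new arc and the links `L₁` close a cycle through `v`, `Q₁` and `q`. They join the core,
    -- and `q` represents the merged component as the new top.
    collapse : ∀ {i C K L v Q U x y q} → Arrow (A i) x y → Equiv K y v → Equiv K x q →
      (S : Split K L v Q q) → let open Split S in
      State (i ∷ C) K L v Q U → State C ((i , x , y) ∷ L₁ ++ K) L₂ q Q₂ U
    collapse {i} {C} {K} {v = v} {U = U} {x} {y} {q} xy y≈v x≈q
      (split L₁ L₂ Q₁ Q₂ refl refl below above) (state rb ls classes) =
      state (rainbow-resp-↭ ↭-refl rearrange (rainbow-add xy rb)) (links-mono K⊆ below) classes′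
      where
      K′ = (i , x , y) ∷ L₁ ++ K

      rearrange : (i , x , y) ∷ (L₁ ++ L₂) ++ K ↭ L₂ ++ K′
      rearrange = ↭-trans
        (_↭_.prep _ (↭-trans (↭-reflexive (++-assoc L₁ L₂ K)) (Perm.shifts L₁ L₂)))
        (↭-sym (Perm.shift _ L₂ (L₁ ++ K)))

      K⊆ : K ⊆ K′
      K⊆ = there ∘ xs⊆ys++xs K L₁

      q⟶v : Reach K′ q v
      q⟶v = reach-mono K⊆ (proj₂ x≈q) ◅◅ head-edge ◅◅ reach-mono K⊆ (proj₁ y≈v)

      merged : ∀ {z p} → p ∈ v ∷ Q₁ → Equiv K z p → Equiv K′ z q
      merged p∈ (z⟶p , p⟶z) =
        reach-mono K⊆ z⟶p ◅◅ reach-mono there (proj₂ (above p∈)) ,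
        q⟶v ◅◅ reach-mono there (proj₁ (above p∈)) ◅◅ reach-mono K⊆ p⟶z

      classes′ : ∀ z → (Near K′ Q₂ z ⊎ Near K′ U z) ⊎ Equiv K′ z q
      classes′ z with classes z
      ... | inj₂ z≈v = inj₂ (merged (here refl) z≈v)
      ... | inj₁ (inj₂ (u , u∈ , z≈u)) = inj₁ (inj₂ (u , u∈ , equiv-mono K⊆ z≈u))
      ... | inj₁ (inj₁ (p , p∈ , z≈p)) with ∈-++⁻ Q₁ p∈
      ...   | inj₁ p∈Q₁         = inj₂ (merged (there p∈Q₁) z≈p)
      ...   | inj₂ (here refl)  = inj₂ (equiv-mono K⊆ z≈p)
      ...   | inj₂ (there p∈Q₂) = inj₁ (inj₁ (p , p∈Q₂ , equiv-mono K⊆ z≈p))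

    -- In the only critical configuration the unused colour i has an arc from the component
    -- of r back to that of v, and the colour c of the link between them can be reassigned.
    close : ∀ {i C K L v r w x y} → Arrow (A i) x y → Equiv K y v → Equiv K x r →
      State (i ∷ C) K L v [ r ] [ w ] → Spanning
    close {i} {C} {K} {v = v} {r} {w} {x = x} {y} xy y≈v x≈r
      (state rb (link {c} {x₀} {y₀} v⟶x₀ y₀⟶r []) classes) = by-source-i (class (source i))
      where
      X = (c , x₀ , y₀) ∷ K

      class : ∀ z → (Equiv K z v ⊎ Equiv K z r) ⊎ Equiv K z w
      class z with classes z
      ... | inj₂ z≈v = inj₁ (inj₁ z≈v)
      ... | inj₁ (inj₁ (_ , here refl , z≈r)) = inj₁ (inj₂ z≈r)
      ... | inj₁ (inj₂ (_ , here refl , z≈w)) = inj₂ z≈w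

      class′ : ∀ z → (Equiv K z w ⊎ Equiv K z r) ⊎ Equiv K z v
      class′ z with class z
      ... | inj₁ (inj₁ z≈v) = inj₂ z≈v
      ... | inj₁ (inj₂ z≈r) = inj₁ (inj₂ z≈r)
      ... | inj₂ z≈w        = inj₁ (inj₁ z≈w)

      finish : ∀ {C Y t} → Rainbow C Y → K ⊆ Y → Reach Y t v → Reach Y t r → Reach Y t w → Spanning
      finish {Y = Y} {t} rbY K⊆Y t⟶v t⟶r t⟶w = _ , Y , t , rbY , λ z →
        [ [ via t⟶v , via t⟶r ]′ , via t⟶w ]′ (class z)
        where
        via : ∀ {z p} → Reach Y t p → Equiv K z p → Reach Y t z
        via t⟶p (_ , p⟶z) = t⟶p ◅◅ reach-mono K⊆Y p⟶z

      v⟶r : Reach X v r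
      v⟶r = link-reach [] v⟶x₀ y₀⟶r

      up₁ : ∀ {e a b} → Reach K a b → Reach (e ∷ K) a b
      up₁ = reach-mono there

      up₂ : ∀ {e f a b} → Reach K a b → Reach (e ∷ f ∷ K) a b
      up₂ = reach-mono (there ∘ there)

      if-v⟶w : Reach X v w → Spanning
      if-v⟶w v⟶w = finish rb there ε v⟶r v⟶w

      v⟶ : ∀ {z} → Equiv K z v ⊎ Equiv K z r → Reach X v z
      v⟶ (inj₁ (_ , v⟶z)) = up₁ v⟶z
      v⟶ (inj₂ (_ , r⟶z)) = v⟶r ◅◅ up₁ r⟶z

      -- Colour `i` now offers arcs from `r` to `v` and from `w` to `r`. If `c` is rooted at `v` or
      -- `r`, the first is combined with an arc of `c` into `w`, with root `r`; if at `w`, the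
      -- second is combined with an arc of `c` into `v`, with root `w`.
      by-source-c : ∀ {a b} → Arrow (A i) a b → Equiv K a w → Equiv K b r →
        (Equiv K (source c) v ⊎ Equiv K (source c) r) ⊎ Equiv K (source c) w → Spanning
      by-source-c ab a≈w b≈r (inj₁ s≈) with crossing class (reach c w) s≈
      ... | inj₂ w≈ = if-v⟶w (v⟶ w≈)
      ... | inj₁ (a′ , b′ , a′b′ , a′≈ , b′≈w) =
        finish (rainbow-add xy (rainbow-replace a′b′ rb)) (there ∘ there) r⟶v ε
          (r⟶a′ a′≈ ◅◅ reach-mono there head-edge ◅◅ up₂ (proj₁ b′≈w))
        where
        Y = (i , x , y) ∷ (c , a′ , b′) ∷ K

        r⟶v : Reach Y r v
        r⟶v = up₂ (proj₂ x≈r) ◅◅ head-edge ◅◅ up₂ (proj₁ y≈v)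

        r⟶a′ : Equiv K a′ v ⊎ Equiv K a′ r → Reach Y r a′
        r⟶a′ (inj₁ (_ , v⟶a′)) = r⟶v ◅◅ up₂ v⟶a′
        r⟶a′ (inj₂ (_ , r⟶a′)) = up₂ r⟶a′
      by-source-c {a} {b} ab a≈w b≈r (inj₂ s≈w) with crossing class′ (reach c v) (inj₁ s≈w)
      ... | inj₂ (inj₁ v≈w) = if-v⟶w (up₁ (proj₁ v≈w))
      ... | inj₂ (inj₂ v≈r) = finish (rainbow-add ab rb) (there ∘ there) (w⟶r ◅◅ up₂ (proj₂ v≈r)) w⟶r ε
        where
        w⟶r : Reach ((i , a , b) ∷ X) w r
        w⟶r = up₂ (proj₂ a≈w) ◅◅ head-edge ◅◅ up₂ (proj₁ b≈r)
      ... | inj₁ (a′ , b′ , a′b′ , a′≈ , b′≈v) =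
        finish (rainbow-add ab (rainbow-replace a′b′ rb)) (there ∘ there)
          (w⟶a′ a′≈ ◅◅ reach-mono there head-edge ◅◅ up₂ (proj₁ b′≈v)) w⟶r ε
        where
        Y = (i , a , b) ∷ (c , a′ , b′) ∷ K

        w⟶r : Reach Y w r
        w⟶r = up₂ (proj₂ a≈w) ◅◅ head-edge ◅◅ up₂ (proj₁ b≈r)

        w⟶a′ : Equiv K a′ w ⊎ Equiv K a′ r → Reach Y w a′
        w⟶a′ (inj₁ (_ , w⟶a′)) = up₂ w⟶a′
        w⟶a′ (inj₂ (_ , r⟶a′)) = w⟶r ◅◅ up₂ r⟶a′

      -- The link can keep its arc if `i` has an arc into `w` from `v` or `r`, or one from `w` into
      -- `v`. Only an arc from `w` into `r` forces `c` to be reassigned.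
      by-source-i : (Equiv K (source i) v ⊎ Equiv K (source i) r) ⊎ Equiv K (source i) w → Spanning
      by-source-i (inj₁ s≈) with crossing class (reach i w) s≈
      ... | inj₂ w≈ = if-v⟶w (v⟶ w≈)
      ... | inj₁ (a , b , ab , a≈ , b≈w) =
        finish (rainbow-add ab rb) (there ∘ there) ε (reach-mono there v⟶r)
          (reach-mono there (v⟶ a≈) ◅◅ head-edge ◅◅ up₂ (proj₁ b≈w))
      by-source-i (inj₂ s≈w) with crossing (swap ∘ class) (reach i v) s≈w
      ... | inj₂ v≈w = if-v⟶w (up₁ (proj₁ v≈w))
      ... | inj₁ (a , b , ab , a≈w , inj₂ b≈r) = by-source-c ab a≈w b≈r (class (source c))
      ... | inj₁ (a , b , ab , a≈w , inj₁ b≈v) =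
        finish (rainbow-add ab rb) (there ∘ there) w⟶v (w⟶v ◅◅ reach-mono there v⟶r) ε
        where
        w⟶v : Reach ((i , a , b) ∷ X) w v
        w⟶v = up₂ (proj₂ a≈w) ◅◅ head-edge ◅◅ up₂ (proj₁ b≈v)

    -- The main loop

    close-or-collapse : ∀ {c i C K L v Q u U x y q} → Arrow (A i) x y → Equiv K y v → Equiv K x q →
      (S : Split K L v Q q) → State (i ∷ C) K L v Q (u ∷ U) → let open Split S in
      Enough (suc c) (length Q) (suc (length U)) →
      Spanning ⊎ Enough c (length Q₂) (suc (length U))
    close-or-collapse {U = U} xy y≈v x≈q (split L₁ L₂ Q₁ Q₂ refl refl below above) st enough
      with enough-collapse (length Q₁) (length Q₂)
             (subst (λ l → Enough _ l _) (length-++ Q₁) enough)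
    ... | inj₁ enough′ = inj₂ enough′
    -- The exceptional case of `enough-collapse` empties `Q₁`, `Q₂` and `U`, which leaves the three
    -- components that `close` handles.
    close-or-collapse {U = []} xy y≈v x≈q (split L₁ L₂ [] [] refl refl below above) st enough
        | inj₂ (refl , refl , refl) = inj₁ (close xy y≈v x≈q st)

    visited? : ∀ {C K L v Q U} → State C K L v Q U → ∀ z → Reach (L ++ K) v z ⊎ Near (L ++ K) U z
    visited? {K = K} {L} (state _ ls classes) z with classes z
    ... | inj₂ (_ , v⟶z) = inj₁ (reach-mono (xs⊆ys++xs K L) v⟶z)
    ... | inj₁ (inj₁ (q , q∈ , _ , q⟶z)) = inj₁ (links-reach ls q∈ ◅◅ reach-mono (xs⊆ys++xs K L) q⟶z)
    ... | inj₁ (inj₂ (u , u∈ , z≈u)) = inj₂ (u , u∈ , equiv-mono (xs⊆ys++xs K L) z≈u)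

    -- Recording `z ≢ v` guarantees that a walk ending at `v` really crosses into its component.
    outside? : ∀ {C K L v Q U} → State C K L v Q U →
      ∀ z → (z ≢ v × (Near K Q z ⊎ Near K U z)) ⊎ Equiv K z v
    outside? {v = v} (state _ _ classes) z with z ≟ v
    ... | yes refl = inj₂ (ε , ε)
    ... | no z≢v   = Sum.map₁ (z≢v ,_) (classes z)

    run : ∀ c {C K L v Q U} → length C ≡ c → State C K L v Q U →
      Enough c (length Q) (length U) → Spanning
    run c {C} {K} {L} {v} {U = []} _ st _ = C , L ++ K , v , State.isRainbow st , λ z →
      [ id , (λ { (_ , () , _) }) ]′ (visited? st z)
    run zero {Q = Q} {U = _ ∷ _} _ _ enough with () ← enough-for-unvisited (length Q) enough
    run (suc c) {C} {K} {L} {v} {Q} {U@(_ ∷ _)} eq st@(state rb ls classes) enough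
      with All.decide (λ i → swap (outside? st (source i))) C
    ... | inj₁ rooted =
      extend-to-all C (L ++ K) U rb
        (≤-trans (enough-for-unvisited (length Q) enough) (≤-reflexive (sym eq)))
        (All.map (reach-mono (xs⊆ys++xs K L) ∘ proj₂) rooted) (visited? st)
    ... | inj₂ unrooted with i , i∈ , s-outside ← find unrooted with C′ , perm ← extract i∈
      with crossing (outside? st) (reach i v) s-outside
    ...   | inj₂ (v≢v , _) = ⊥-elim (v≢v refl)
    ...   | inj₁ (x , y , xy , (_ , x-class) , y≈v) = continue x-class
      where
      eq′ : length C′ ≡ c
      eq′ = suc-injective (trans (sym (Perm.↭-length perm)) eq)

      st′ : State (i ∷ C′) K L v Q U
      st′ = state (rainbow-resp-↭ perm ↭-refl rb) ls classes

      continue : Near K Q x ⊎ Near K U x → Spanning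
      continue (inj₂ (u , u∈ , x≈u)) with U′ , permU ← extract u∈ =
        run c eq′ (push xy y≈v x≈u permU st′)
          (enough-push {q = length Q} (subst (Enough (suc c) (length Q)) (Perm.↭-length permU) enough))
      continue (inj₁ (q , q∈ , x≈q)) with close-or-collapse xy y≈v x≈q (links-split ls q∈) st′ enough
      ... | inj₁ spanning = spanning
      ... | inj₂ enough′  = run c eq′ (collapse xy y≈v x≈q (links-split ls q∈) st′) enough′

-- The initial state and the two bounds

enough⇒arborescence : ∀ {n k} (A : Fin k → Digraph (suc n)) → (∀ i → IsSpanningArborescence (A i)) →
  Enough k 0 n → HasRainbowSpanningArborescence A
enough⇒arborescence {n} {k} A arb enough =
  spanning⇒arborescence A (run A (proj₁ ∘ rooted) (proj₂ ∘ rooted) k (length-tabulate id) start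
    (subst (Enough k 0) (sym (length-tabulate suc)) enough))
  where
  rooted : ∀ i → ∃ λ r → ∀ z → Star (Arrow (A i)) r z
  rooted i = arborescence-reach (A i) (arb i)

  -- The core is empty and the stack holds only vertex `zero`; each of the other `n` vertices is an
  -- unvisited component of its own.
  start : State A (proj₁ ∘ rooted) (proj₂ ∘ rooted) (allFin k) [] [] zero [] (tabulate suc)
  start = state (rainbow (subst Unique (sym (++-identityʳ (allFin k))) (allFin⁺ k)) []) [] λ where
    zero    → inj₂ (ε , ε)
    (suc z) → inj₁ (inj₂ (suc z , ∈-tabulate⁺ z , ε , ε))

theorem4p1 : (n k : ℕ) → 2 ≤ n →
    (A : Fin k → Digraph n) → ((i : Fin k) → IsSpanningArborescence (A i)) →
    ((2 * n ≤ k + 3 → HasRainbowSpanningArborescence A) ×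
    (3 ≤ n → 2 * n ≤ k + 4 → HasRainbowSpanningArborescence A))
theorem4p1 (suc n) k _ A arb =
  (λ le → enough⇒arborescence A arb (inj₁ (halve 1 le))) ,
  (λ 3≤n le → enough⇒arborescence A arb (inj₂ (halve 2 le , s≤s⁻¹ 3≤n)))
  where
  -- With `suc n` vertices, `n` are unvisited at the start, so two cancels on both sides; `d` is the
  -- slack of the matching alternative of `Enough`.
  halve : ∀ d → 2 * suc n ≤ k + suc (suc d) → n + n ≤ d + k
  halve d le rewrite +-identityʳ n | +-suc n n | +-comm k (suc (suc d)) = s≤s⁻¹ (s≤s⁻¹ le)
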